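{- The only Lucas numbers $L_k$ with $k\ge 1$ that can be written as a product of three (decimal) repdigits, i.e. in the form $$L_k=d_1\frac{10^\ell-1}{9}\cdot d_2\frac{10^m-1}{9}\cdot d_3\frac{10^n-1}{9}$$ with positive integers $\ell\le m\le n$ and $1\le d_1,d_2,d_3\le 9$, are $1,3,4,7,11$ and $18$.
   Context: $(L_k)$ is the Lucas sequence: $L_0=2$, $L_1=1$, $L_{k+2}=L_{k+1}+L_k$. A repdigit is a positive integer all of whose decimal digits are equal, i.e. a number $d\frac{10^j-1}{9}$ with $j\ge1$, $1\le d\le 9$. -}

module Defs where

open import Data.Nat using (ℕ; zero; suc; _+_; _*_; _∸_; _^_; _/_)

L : ℕ → ℕ
L zero = 2
L (suc zero) = 1
L (suc (suc k)) = L (suc k) + L k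

repdigit : ℕ → ℕ → ℕ
repdigit d j = d * ((10 ^ j ∸ 1) / 9)

{-# OPTIONS --safe #-}
-- If all three repunits have at most two digits, the product is at most 99³, so k < 30 and
-- finitely many cases remain. Otherwise the equation already fails modulo
-- 46200 = 2³ · 3 · 5² · 7 · 11: there the Lucas sequence has period 240 and the repunits have
-- period 6 from 111 onwards, so both sides take few residues.
module Submission where

open import Defs
open import Data.Nat using (ℕ; _*_; _≤_)
open import Data.Product using (_×_; ∃-syntax)
open import Data.Sum using (_⊎_)
open import Relation.Binary.PropositionalEquality using (_≡_)

open import Data.List using (List; []; _∷_; applyUpTo; upTo; cartesianProductWith; deduplicate; iterate; map)
import Data.List.Membership.DecPropositional as DecMembership
open import Data.List.Membership.Propositional using (_∈_; _∉_)
open import Data.List.Membership.Propositional.Properties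
  using (∈-applyUpTo⁺; ∈-cartesianProductWith⁺; ∈-deduplicate⁺; ∈-map⁺; ∈-upTo⁺)
open import Data.List.Relation.Unary.All as All using (All; all?)
open import Data.List.Relation.Unary.Any using (here; there)
open import Data.Nat
  using (zero; suc; _+_; _∸_; _^_; _/_; _%_; _<_; _≟_; _≤?_; _<?_; _≤′_; ≤′-reflexive; ≤′-step; NonZero; z≤n; s≤s; s≤s⁻¹)
open import Data.Nat.DivMod using (m*n/n≡m; m%n%n≡m%n; %-distribˡ-+; %-distribˡ-*)
import Data.Nat.GeneralisedArithmetic as Nat
open import Data.Nat.Properties
  using (+-comm; *-assoc; *-distribˡ-+; *-distribʳ-+; [m*n]*[o*p]≡[m*o]*[n*p]; m≤m+n;
         ≤-refl; ≤-trans; <-≤-trans; <⇒≱; ≰⇒>; ≤⇒≤′; ≤′⇒≤)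
open import Data.Product using (_,_; proj₁)
open import Data.Sum as Sum using (inj₁; inj₂)
open import Function using (id)
open import Relation.Binary.PropositionalEquality
  using (_≢_; refl; sym; trans; cong; cong₂; subst; module ≡-Reasoning)
open import Relation.Nullary using (Dec; yes; no; ¬?; _⊎-dec_; contradiction)
open import Relation.Nullary.Decidable using (True; toWitness)

open DecMembership _≟_ using (_∈?_)

-- Repunits, and separating the digits from them.

repunit : ℕ → ℕ
repunit zero    = 0
repunit (suc j) = 10 * repunit j + 1

-- Shows that the division by 9 in `repdigit` is exact, so it can be replaced by the recursion x ↦
-- 10x + 1, which is compatible with reduction modulo q.
10^≡1+repunit*9 : ∀ j → 10 ^ j ≡ 1 + repunit j * 9
10^≡1+repunit*9 zero    = refl
10^≡1+repunit*9 (suc j) = begin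
  10 * 10 ^ j                  ≡⟨ cong (10 *_) (10^≡1+repunit*9 j) ⟩
  10 * (1 + repunit j * 9)     ≡⟨ *-distribˡ-+ 10 1 (repunit j * 9) ⟩
  10 + 10 * (repunit j * 9)    ≡⟨ cong (10 +_) (sym (*-assoc 10 (repunit j) 9)) ⟩
  10 + 10 * repunit j * 9      ≡⟨ cong suc (+-comm 9 (10 * repunit j * 9)) ⟩
  1 + (10 * repunit j * 9 + 9) ≡⟨ cong suc (sym (*-distribʳ-+ 9 (10 * repunit j) 1)) ⟩
  1 + repunit (suc j) * 9      ∎
  where open ≡-Reasoning

repdigit≡*repunit : ∀ d j → repdigit d j ≡ d * repunit j
repdigit≡*repunit d j = cong (d *_)
  (trans (cong (λ x → (x ∸ 1) / 9) (10^≡1+repunit*9 j)) (m*n/n≡m (repunit j) 9))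

product-of-repdigits : ∀ d₁ d₂ d₃ ℓ m n →
  repdigit d₁ ℓ * repdigit d₂ m * repdigit d₃ n
    ≡ (d₁ * d₂ * d₃) * (repunit ℓ * repunit m * repunit n)
product-of-repdigits d₁ d₂ d₃ ℓ m n = begin
  repdigit d₁ ℓ * repdigit d₂ m * repdigit d₃ n
    ≡⟨ cong₂ _*_ (cong₂ _*_ (repdigit≡*repunit d₁ ℓ) (repdigit≡*repunit d₂ m)) (repdigit≡*repunit d₃ n) ⟩
  d₁ * repunit ℓ * (d₂ * repunit m) * (d₃ * repunit n)
    ≡⟨ cong (_* (d₃ * repunit n)) ([m*n]*[o*p]≡[m*o]*[n*p] d₁ (repunit ℓ) d₂ (repunit m)) ⟩
  d₁ * d₂ * (repunit ℓ * repunit m) * (d₃ * repunit n)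
    ≡⟨ [m*n]*[o*p]≡[m*o]*[n*p] (d₁ * d₂) (repunit ℓ * repunit m) d₃ (repunit n) ⟩
  d₁ * d₂ * d₃ * (repunit ℓ * repunit m * repunit n) ∎
  where open ≡-Reasoning

-- Finite sets of products.

infixl 7 _⊗_

-- Only the set of values matters. Many digit triples share a product, so removing duplicates
-- shortens the later searches.
_⊗_ : List ℕ → List ℕ → List ℕ
xs ⊗ ys = deduplicate _≟_ (cartesianProductWith _*_ xs ys)

∈-⊗ : ∀ xs ys {x y} → x ∈ xs → y ∈ ys → x * y ∈ xs ⊗ ys
∈-⊗ xs ys x∈xs y∈ys = ∈-deduplicate⁺ _≟_ (∈-cartesianProductWith⁺ _*_ x∈xs y∈ys)

digits digitProducts : List ℕ
digits        = applyUpTo suc 9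
digitProducts = digits ⊗ digits ⊗ digits

∈-digits : ∀ {d} → 1 ≤ d → d ≤ 9 → d ∈ digits
∈-digits {suc d} _ d<9 = ∈-applyUpTo⁺ suc d<9

∈-digitProducts : ∀ {d₁ d₂ d₃} → d₁ ∈ digits → d₂ ∈ digits → d₃ ∈ digits → d₁ * d₂ * d₃ ∈ digitProducts
∈-digitProducts d₁∈ d₂∈ d₃∈ = ∈-⊗ (digits ⊗ digits) digits (∈-⊗ digits digits d₁∈ d₂∈) d₃∈

answers : List ℕ
answers = 1 ∷ 3 ∷ 4 ∷ 7 ∷ 11 ∷ 18 ∷ []

∈-answers⁻ : ∀ {x} → x ∈ answers → x ≡ 1 ⊎ x ≡ 3 ⊎ x ≡ 4 ⊎ x ≡ 7 ⊎ x ≡ 11 ⊎ x ≡ 18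
∈-answers⁻ (here eq)                                         = inj₁ eq
∈-answers⁻ (there (here eq))                                 = inj₂ (inj₁ eq)
∈-answers⁻ (there (there (here eq)))                         = inj₂ (inj₂ (inj₁ eq))
∈-answers⁻ (there (there (there (here eq))))                 = inj₂ (inj₂ (inj₂ (inj₁ eq)))
∈-answers⁻ (there (there (there (there (here eq)))))         = inj₂ (inj₂ (inj₂ (inj₂ (inj₁ eq))))
∈-answers⁻ (there (there (there (there (there (here eq)))))) = inj₂ (inj₂ (inj₂ (inj₂ (inj₂ eq))))

-- Periodic orbits as finite invariant sets.

iterate-closed : ∀ {A : Set} (f : A → A) x n {y} → y ∈ iterate f x n → f y ∈ iterate f x n ⊎ f y ≡ Nat.iterate f x n
iterate-closed f x (suc zero)    (here refl) = inj₂ refl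
iterate-closed f x (suc (suc n)) (here refl) = inj₁ (there (here refl))
iterate-closed f x (suc n)       (there y∈)  = Sum.map₁ there (iterate-closed f (f x) n y∈)

-- Each entry is sent to its successor in the list; only the last one could escape, and periodicity
-- sends it back to `x`.
orbit-closed : ∀ {A : Set} (f : A → A) x n → Nat.iterate f x (suc n) ≡ x →
  ∀ {y} → y ∈ iterate f x (suc n) → f y ∈ iterate f x (suc n)
orbit-closed f x n periodic y∈ with iterate-closed f x (suc n) y∈
... | inj₁ fy∈ = fy∈
... | inj₂ eq  = here (trans eq periodic)

-- Products, repunits and Lucas numbers modulo q.

module Residues (q : ℕ) .{{_ : NonZero q}} where

  infixl 7 _⊗%_

  _⊗%_ : List ℕ → List ℕ → List ℕ
  xs ⊗% ys = deduplicate _≟_ (map (_% q) (cartesianProductWith _*_ xs ys))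

  ∈-⊗% : ∀ xs ys {x y} → x % q ∈ xs → y % q ∈ ys → (x * y) % q ∈ xs ⊗% ys
  ∈-⊗% xs ys {x} {y} x∈xs y∈ys = subst (_∈ _) (sym (%-distribˡ-* x y q))
    (∈-deduplicate⁺ _≟_ (∈-map⁺ (_% q) (∈-cartesianProductWith⁺ _*_ x∈xs y∈ys)))

  *-%-absorbʳ : ∀ x y → (x * (y % q)) % q ≡ (x * y) % q
  *-%-absorbʳ x y = begin
    (x * (y % q)) % q             ≡⟨ %-distribˡ-* x (y % q) q ⟩
    ((x % q) * (y % q % q)) % q   ≡⟨ cong (λ z → ((x % q) * z) % q) (m%n%n≡m%n y q) ⟩
    ((x % q) * (y % q)) % q       ≡⟨ %-distribˡ-* x y q ⟨
    (x * y) % q                   ∎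
    where open ≡-Reasoning

  next : ℕ → ℕ
  next x = (10 * x + 1) % q

  next-% : ∀ x → next (x % q) ≡ next x
  next-% x = begin
    (10 * (x % q) + 1) % q             ≡⟨ %-distribˡ-+ (10 * (x % q)) 1 q ⟩
    ((10 * (x % q)) % q + 1 % q) % q   ≡⟨ cong (λ y → (y + 1 % q) % q) (*-%-absorbʳ 10 x) ⟩
    ((10 * x) % q + 1 % q) % q         ≡⟨ %-distribˡ-+ (10 * x) 1 q ⟨
    (10 * x + 1) % q                   ∎
    where open ≡-Reasoning

  -- The start at index 3 suits the modulus 46200: its factor 2³ divides 10^j only from j = 3 on, so
  -- 1 and 11 lie before the cycle.
  repunit-∈ : ∀ {xs} → repunit 3 % q ∈ xs → (∀ {x} → x ∈ xs → next x ∈ xs) → ∀ j → repunit (3 + j) % q ∈ xs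
  repunit-∈ base closed zero    = base
  repunit-∈ base closed (suc j) =
    subst (_∈ _) (next-% (repunit (3 + j))) (closed (repunit-∈ base closed j))

  -- The state is a pair of consecutive residues because the recurrence has order two: a single
  -- residue does not determine the next one.
  step : ℕ × ℕ → ℕ × ℕ
  step (a , b) = b , (b + a) % q

  lucas-∈ : ∀ {ps} → (2 % q , 1 % q) ∈ ps → (∀ {p} → p ∈ ps → step p ∈ ps) → ∀ k → (L k % q , L (suc k) % q) ∈ ps
  lucas-∈ base closed zero    = base
  lucas-∈ base closed (suc k) = subst (λ x → (L (suc k) % q , x) ∈ _)
    (sym (%-distribˡ-+ (L (suc k)) (L k) q)) (closed (lucas-∈ base closed k))

  -- Comparing modulo the auxiliary r first rejects most pairs against a short list, which
  -- keeps the evaluation of this decision procedure cheap.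
  Disjoint : (r : ℕ) .{{_ : NonZero r}} → List ℕ → List ℕ → List ℕ → List ℕ → Set
  Disjoint r xs′ xs ys zs =
    All (λ y → All (λ z → (y * z) % q % r ∉ xs′ ⊎ (y * z) % q ∉ xs) zs) ys

  disjoint? : ∀ r .{{_ : NonZero r}} xs′ xs ys zs → Dec (Disjoint r xs′ xs ys zs)
  disjoint? r xs′ xs ys zs =
    all? (λ y → all? (λ z → ¬? ((y * z) % q % r ∈? xs′) ⊎-dec ¬? ((y * z) % q ∈? xs)) zs) ys

  -- A residue in `xs` would have its reduction modulo `r` in the reduced list, so either reason for
  -- rejecting a pair gives a contradiction. The factor `y` stays exact; only `z` is replaced by its
  -- residue.
  Disjoint⇒∉ : ∀ r .{{_ : NonZero r}} xs {ys zs} →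
    Disjoint r (deduplicate _≟_ (map (_% r) xs)) xs ys zs →
    ∀ y z → y ∈ ys → z % q ∈ zs → (y * z) % q ∉ xs
  Disjoint⇒∉ r xs disjoint y z y∈ z∈ yz∈ with All.lookup (All.lookup disjoint y∈) z∈
  ... | inj₁ ∉xs′ = ∉xs′ (∈-deduplicate⁺ _≟_ (∈-map⁺ (_% r) (subst (_∈ xs) (sym (*-%-absorbʳ y z)) yz∈)))
  ... | inj₂ ∉xs  = ∉xs (subst (_∈ xs) (sym (*-%-absorbʳ y z)) yz∈)

-- The obstruction modulo 46200.

open Residues 46200

lucasStates : List (ℕ × ℕ)
lucasStates = iterate step (2 , 1) 240

-- In `productResidues` only the last factor is restricted to the cycle: the largest index is at
-- least 3, while the other two may still be 1 or 2.
lucasResidues longResidues allResidues productResidues : List ℕ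
lucasResidues   = map proj₁ lucasStates
longResidues    = iterate next 111 6
allResidues     = 1 ∷ 11 ∷ longResidues
productResidues = allResidues ⊗% allResidues ⊗% longResidues

L-%-∈ : ∀ k → L k % 46200 ∈ lucasResidues
-- The period is 239 + 1 = 240; the second `refl` checks by evaluation that 240 steps lead back to
-- (2 , 1).
L-%-∈ k = ∈-map⁺ proj₁ (lucas-∈ (here refl) (orbit-closed step (2 , 1) 239 refl) k)

repunit-%-∈-long : ∀ {j} → 3 ≤ j → repunit j % 46200 ∈ longResidues
repunit-%-∈-long {suc (suc (suc j))} _       = repunit-∈ (here refl) (orbit-closed next 111 5 refl) j
repunit-%-∈-long {suc (suc zero)}    (s≤s (s≤s ()))
repunit-%-∈-long {suc zero}          (s≤s ())

repunit-%-∈-all : ∀ {j} → 1 ≤ j → repunit j % 46200 ∈ allResidues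
repunit-%-∈-all {suc zero}          _ = here refl
repunit-%-∈-all {suc (suc zero)}    _ = there (here refl)
repunit-%-∈-all {suc (suc (suc j))} _ = there (there (repunit-%-∈-long {3 + j} (s≤s (s≤s (s≤s z≤n)))))

-- Established by evaluation. The auxiliary modulus 275 = 5² · 11 divides 46200, and the Lucas
-- sequence has period only 20 modulo it, so the first list to search has at most 20 entries.
residues-disjoint : Disjoint 275 (deduplicate _≟_ (map (_% 275) lucasResidues)) lucasResidues digitProducts productResidues
residues-disjoint = toWitness
  {a? = disjoint? 275 (deduplicate _≟_ (map (_% 275) lucasResidues)) lucasResidues digitProducts productResidues} _

∉-lucas : ∀ {D ℓ m n} → D ∈ digitProducts → 1 ≤ ℓ → 1 ≤ m → 3 ≤ n →
  ∀ k → L k ≢ D * (repunit ℓ * repunit m * repunit n)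
∉-lucas {D} {ℓ} {m} {n} D∈ 1≤ℓ 1≤m 3≤n k eq =
  Disjoint⇒∉ 275 lucasResidues residues-disjoint D (repunit ℓ * repunit m * repunit n) D∈
    (∈-⊗% (allResidues ⊗% allResidues) longResidues {repunit ℓ * repunit m} {repunit n}
      (∈-⊗% allResidues allResidues {repunit ℓ} {repunit m} (repunit-%-∈-all 1≤ℓ) (repunit-%-∈-all 1≤m))
      (repunit-%-∈-long 3≤n))
    (subst (λ x → x % 46200 ∈ lucasResidues) eq (L-%-∈ k))

-- Repunits of at most two digits.

shortRepunits shortRepunitProducts shortProducts : List ℕ
shortRepunits        = 1 ∷ 11 ∷ []
shortRepunitProducts = shortRepunits ⊗ shortRepunits ⊗ shortRepunits
shortProducts        = digitProducts ⊗ shortRepunitProducts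

repunit-∈-short : ∀ {j} → 1 ≤ j → j ≤ 2 → repunit j ∈ shortRepunits
repunit-∈-short {suc zero}          _ _             = here refl
repunit-∈-short {suc (suc zero)}    _ _             = there (here refl)
repunit-∈-short {suc (suc (suc _))} _ (s≤s (s≤s ()))

∈-shortProducts : ∀ D r₁ r₂ r₃ → D ∈ digitProducts →
  r₁ ∈ shortRepunits → r₂ ∈ shortRepunits → r₃ ∈ shortRepunits → D * (r₁ * r₂ * r₃) ∈ shortProducts
∈-shortProducts D r₁ r₂ r₃ D∈ r₁∈ r₂∈ r₃∈ = ∈-⊗ digitProducts shortRepunitProducts D∈
  (∈-⊗ (shortRepunits ⊗ shortRepunits) shortRepunits (∈-⊗ shortRepunits shortRepunits r₁∈ r₂∈) r₃∈)

-- Each step from a positive index adds an earlier Lucas number. The start at 1 matters, since `L 0`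
-- = 2 exceeds `L 1` = 1.
L-mono : ∀ {m n} → 1 ≤ m → m ≤′ n → L m ≤ L n
L-mono 1≤m (≤′-reflexive refl)     = ≤-refl
L-mono 1≤m (≤′-step {zero} m≤′0)   = contradiction (≤-trans 1≤m (≤′⇒≤ m≤′0)) λ ()
L-mono 1≤m (≤′-step {suc n} m≤′1+n) = ≤-trans (L-mono 1≤m m≤′1+n) (m≤m+n (L (suc n)) (L n))

-- The bound is 729 · 1331 = 99³, reached when all digits are 9 and all repunits are 11.
shortProducts-≤ : All (_≤ 970299) shortProducts
shortProducts-≤ = toWitness {a? = all? (_≤? 970299) shortProducts} _

970299<L29 : 970299 < L 29
970299<L29 = toWitness {a? = 970299 <? L 29} _

-- The shift by one leaves out `L 0` = 2, which is a product of three repdigits but not among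
-- `answers`.
initialLucas : List ℕ
initialLucas = map (λ j → L (suc j)) (upTo 28)

initialLucas-checked : All (λ x → x ∈ answers ⊎ x ∉ shortProducts) initialLucas
initialLucas-checked = toWitness {a? = check answers shortProducts initialLucas} _
  where
  check : ∀ xs ys zs → Dec (All (λ z → z ∈ xs ⊎ z ∉ ys) zs)
  check xs ys zs = all? (λ z → (z ∈? xs) ⊎-dec ¬? (z ∈? ys)) zs

L≤970299⇒<29 : ∀ k → L k ≤ 970299 → k < 29
L≤970299⇒<29 k L≤ = ≰⇒> λ 29≤k →
  <⇒≱ (<-≤-trans 970299<L29 (L-mono {29} {k} (s≤s z≤n) (≤⇒≤′ 29≤k))) L≤

L-∈-initialLucas : ∀ {j} → j < 28 → L (suc j) ∈ initialLucas
L-∈-initialLucas j<28 = ∈-map⁺ (λ j → L (suc j)) (∈-upTo⁺ j<28)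

shortProducts-∩ : ∀ x → x ∈ initialLucas → x ∈ shortProducts → x ∈ answers
shortProducts-∩ x x∈ x∈products = Sum.[ id , contradiction x∈products ]′ (All.lookup initialLucas-checked x∈)

-- The size bound on short products forces k < 29, which leaves only the Lucas numbers already
-- checked.
short-lucas : ∀ k → 1 ≤ k → L k ∈ shortProducts → L k ∈ answers
short-lucas (suc j) 1≤k L∈ = shortProducts-∩ (L (suc j)) (L-∈-initialLucas j<28) L∈
  where
  j<28 : j < 28
  j<28 = s≤s⁻¹ (L≤970299⇒<29 (suc j) (All.lookup shortProducts-≤ L∈))

-- Completeness of the six values, and a factorization of each.

theorem4p2 : (k : ℕ) → 1 ≤ k →
  ((∃[ d₁ ] ∃[ d₂ ] ∃[ d₃ ] ∃[ ℓ ] ∃[ m ] ∃[ n ]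
      ((1 ≤ d₁ × d₁ ≤ 9) × (1 ≤ d₂ × d₂ ≤ 9) × (1 ≤ d₃ × d₃ ≤ 9) ×
       1 ≤ ℓ × ℓ ≤ m × m ≤ n ×
       L k ≡ repdigit d₁ ℓ * repdigit d₂ m * repdigit d₃ n))
    → (L k ≡ 1 ⊎ L k ≡ 3 ⊎ L k ≡ 4 ⊎ L k ≡ 7 ⊎ L k ≡ 11 ⊎ L k ≡ 18))
  × ((L k ≡ 1 ⊎ L k ≡ 3 ⊎ L k ≡ 4 ⊎ L k ≡ 7 ⊎ L k ≡ 11 ⊎ L k ≡ 18)
    → ∃[ d₁ ] ∃[ d₂ ] ∃[ d₃ ] ∃[ ℓ ] ∃[ m ] ∃[ n ]
      ((1 ≤ d₁ × d₁ ≤ 9) × (1 ≤ d₂ × d₂ ≤ 9) × (1 ≤ d₃ × d₃ ≤ 9) ×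
       1 ≤ ℓ × ℓ ≤ m × m ≤ n ×
       L k ≡ repdigit d₁ ℓ * repdigit d₂ m * repdigit d₃ n))
theorem4p2 k 1≤k = only , attained
  where
  IsProduct : ℕ → Set
  IsProduct x = ∃[ d₁ ] ∃[ d₂ ] ∃[ d₃ ] ∃[ ℓ ] ∃[ m ] ∃[ n ]
    ((1 ≤ d₁ × d₁ ≤ 9) × (1 ≤ d₂ × d₂ ≤ 9) × (1 ≤ d₃ × d₃ ≤ 9) ×
     1 ≤ ℓ × ℓ ≤ m × m ≤ n ×
     x ≡ repdigit d₁ ℓ * repdigit d₂ m * repdigit d₃ n)

  only : IsProduct (L k) → L k ≡ 1 ⊎ L k ≡ 3 ⊎ L k ≡ 4 ⊎ L k ≡ 7 ⊎ L k ≡ 11 ⊎ L k ≡ 18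
  only (d₁ , d₂ , d₃ , ℓ , m , n , (1≤d₁ , d₁≤9) , (1≤d₂ , d₂≤9) , (1≤d₃ , d₃≤9) , 1≤ℓ , ℓ≤m , m≤n , L≡) =
    -- As `n` is the largest index, either all three repunits are short or the last one lies in the
    -- cycle modulo 46200.
    conclude (n ≤? 2)
    where
    1≤m : 1 ≤ m
    1≤m = ≤-trans 1≤ℓ ℓ≤m
    D∈ : d₁ * d₂ * d₃ ∈ digitProducts
    D∈ = ∈-digitProducts (∈-digits 1≤d₁ d₁≤9) (∈-digits 1≤d₂ d₂≤9) (∈-digits 1≤d₃ d₃≤9)
    eq : L k ≡ (d₁ * d₂ * d₃) * (repunit ℓ * repunit m * repunit n)
    eq = trans L≡ (product-of-repdigits d₁ d₂ d₃ ℓ m n)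
    conclude : Dec (n ≤ 2) → L k ≡ 1 ⊎ L k ≡ 3 ⊎ L k ≡ 4 ⊎ L k ≡ 7 ⊎ L k ≡ 11 ⊎ L k ≡ 18
    conclude (no n≰2)  = contradiction eq (∉-lucas D∈ 1≤ℓ 1≤m (≰⇒> n≰2) k)
    conclude (yes n≤2) = ∈-answers⁻ (short-lucas k 1≤k (subst (_∈ shortProducts) (sym eq)
      (∈-shortProducts (d₁ * d₂ * d₃) (repunit ℓ) (repunit m) (repunit n) D∈
        (repunit-∈-short 1≤ℓ (≤-trans ℓ≤m m≤2)) (repunit-∈-short 1≤m m≤2) (repunit-∈-short (≤-trans 1≤m m≤n) n≤2))))
      where
      m≤2 : m ≤ 2
      m≤2 = ≤-trans m≤n n≤2

  digit : ∀ d {_ : True (1 ≤? d)} {_ : True (d ≤? 9)} → 1 ≤ d × d ≤ 9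
  digit d {p} {q} = toWitness p , toWitness q

  -- This shape covers all six values: one-digit values use `d` alone, 11 is the repunit with `n` =
  -- 2, and 18 = 2 · 9 uses both digits. The bounds on numerals are decided by evaluation.
  witness : ∀ d e n {_ : True (1 ≤? d)} {_ : True (d ≤? 9)} {_ : True (1 ≤? e)} {_ : True (e ≤? 9)} {_ : True (1 ≤? n)} →
    L k ≡ repdigit d 1 * repdigit e 1 * repdigit 1 n → IsProduct (L k)
  witness d e n {d₁} {d₂} {e₁} {e₂} {n₁} eq =
    d , e , 1 , 1 , 1 , n , digit d {d₁} {d₂} , digit e {e₁} {e₂} , digit 1 , ≤-refl , ≤-refl , toWitness n₁ , eq

  attained : L k ≡ 1 ⊎ L k ≡ 3 ⊎ L k ≡ 4 ⊎ L k ≡ 7 ⊎ L k ≡ 11 ⊎ L k ≡ 18 → IsProduct (L k)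
  attained (inj₁ eq)                             = witness 1 1 1 eq
  attained (inj₂ (inj₁ eq))                      = witness 3 1 1 eq
  attained (inj₂ (inj₂ (inj₁ eq)))               = witness 4 1 1 eq
  attained (inj₂ (inj₂ (inj₂ (inj₁ eq))))        = witness 7 1 1 eq
  attained (inj₂ (inj₂ (inj₂ (inj₂ (inj₁ eq))))) = witness 1 1 2 eq
  attained (inj₂ (inj₂ (inj₂ (inj₂ (inj₂ eq))))) = witness 2 9 1 eq
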